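{- Let $m=2k+1$ be odd and let $m\ge n\ge 3$. If $S$ is an optimal contamination set of $G(n,m)$ and $|S|=k+1$, then: 1. each odd column (column of odd index) contains exactly one cell of $S$; 2. each even column contains no cell of $S$. In particular, every optimal solution is supported on the odd columns $1,3,5,\dots,2k+1$.
   Context: For integers $n,m\ge 1$, the grid $G(n,m)$ has cell set $V_{n,m}=\{(i,j): 1\le i\le n,\ 1\le j\le m\}$ ($i$ = row, $j$ = column). Contamination rules: a cell $u=(i,j)\in V_{n,m}$ can be contaminated by two contaminated cells $v,w\in V_{n,m}$ if one of the following holds: (a) $v=(i-1,j-1)$, $w=(i+1,j+1)$; (b) $v=(i+1,j-1)$, $w=(i-1,j+1)$; (c) $v=(i-1,j)$, $w=(i+1,j)$; (d) $v=(i,j-1)$, $w=(i,j+1)$; (e) $v=(i,j-1)$, $w=(i-1,j)$; (f) $v=(i,j-1)$, $w=(i+1,j)$; (g) $v=(i+1,j)$, $w=(i,j+1)$; (h) $v=(i-1,j)$, $w=(i,j+1)$. For $S\subseteq V_{n,m}$, the final contaminated set $C(S)$ is the smallest subset of $V_{n,m}$ containing $S$ and closed under rules (a)--(h). $S$ is a contaminating set if $C(S)=V_{n,m}$. The power contamination number $\gamma_c(G(n,m))$ is the minimum cardinality of a contaminating set, and a contaminating set $S$ with $|S|=\gamma_c(G(n,m))$ is called an optimal contamination set (optimal solution). A set is supported on the odd columns if all its cells lie in columns of odd index. -}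

module Defs where

open import Data.Fin using (Fin; toℕ; combine)
open import Data.Fin.Subset using (Subset) renaming (_∈_ to _∈ᶠ_; ∣_∣ to ∣_∣ᶠ)
open import Data.Nat using (ℕ; suc; _*_; _≤_)
open import Data.Nat.Divisibility using (_∣_; _∤_)
open import Data.Product using (_×_; _,_; ∃; proj₁; proj₂)
open import Relation.Binary.PropositionalEquality using (_≡_)
open import Relation.Nullary using (¬_)

private
  variable
    n m : ℕ

Cell : ℕ → ℕ → Set
Cell n m = Fin n × Fin m

-- The mathematical indices run from 1, whereas toℕ starts at 0.
index : Fin n → ℕ
index x = suc (toℕ x)

row : Cell n m → ℕ
row u = index (proj₁ u)

col : Cell n m → ℕ
col u = index (proj₂ u)

-- Sets of cells are subsets of Fin (n * m), through the bijection `combine`,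
-- so that the cardinality is the one of Data.Fin.Subset.  The record lets n and m be
-- inferred, which Subset (n * m) alone would not.
record CellSet (n m : ℕ) : Set where
  constructor cells
  field
    subset : Subset (n * m)

open CellSet public

∣_∣ : CellSet n m → ℕ
∣ S ∣ = ∣ subset S ∣ᶠ

infix 4 _∈_ _∉_

_∈_ : Cell n m → CellSet n m → Set
(i , j) ∈ S = combine i j ∈ᶠ subset S

_∉_ : Cell n m → CellSet n m → Set
u ∉ S = ¬ (u ∈ S)

-- `Rule u v w`: with u = (i , j), the positions of v and w relative to u allow
-- them to contaminate u.  A coordinate i - 1 of v is written suc (row v) ≡ row u,
-- which avoids truncated subtraction.
data Rule (u v w : Cell n m) : Set where
  -- v = (i-1 , j-1), w = (i+1 , j+1)
  a : suc (row v) ≡ row u → suc (col v) ≡ col u →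
      row w ≡ suc (row u) → col w ≡ suc (col u) → Rule u v w
  -- v = (i+1 , j-1), w = (i-1 , j+1)
  b : row v ≡ suc (row u) → suc (col v) ≡ col u →
      suc (row w) ≡ row u → col w ≡ suc (col u) → Rule u v w
  -- v = (i-1 , j), w = (i+1 , j)
  c : suc (row v) ≡ row u → col v ≡ col u →
      row w ≡ suc (row u) → col w ≡ col u → Rule u v w
  -- v = (i , j-1), w = (i , j+1)
  d : row v ≡ row u → suc (col v) ≡ col u →
      row w ≡ row u → col w ≡ suc (col u) → Rule u v w
  -- v = (i , j-1), w = (i-1 , j)
  e : row v ≡ row u → suc (col v) ≡ col u →
      suc (row w) ≡ row u → col w ≡ col u → Rule u v w
  -- v = (i , j-1), w = (i+1 , j)
  f : row v ≡ row u → suc (col v) ≡ col u →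
      row w ≡ suc (row u) → col w ≡ col u → Rule u v w
  -- v = (i+1 , j), w = (i , j+1)
  g : row v ≡ suc (row u) → col v ≡ col u →
      row w ≡ row u → col w ≡ suc (col u) → Rule u v w
  -- v = (i-1 , j), w = (i , j+1)
  h : suc (row v) ≡ row u → col v ≡ col u →
      row w ≡ row u → col w ≡ suc (col u) → Rule u v w

-- The final contaminated set: the least set of cells containing S and closed
-- under the rules.
data C (S : CellSet n m) : Cell n m → Set where
  initial : ∀ {u} → u ∈ S → C S u
  spread  : ∀ {u v w} → Rule u v w → C S v → C S w → C S u

Contaminating : CellSet n m → Set
Contaminating S = ∀ u → C S u

-- `γc[ n , m ]≐ γ`: the power contamination number of G(n , m) is γ.  The minimum is
-- given by its graph, since computing it would require deciding Contaminating.
infix 4 γc[_,_]≐_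

γc[_,_]≐_ : ℕ → ℕ → ℕ → Set
γc[ n , m ]≐ γ =
  (∃ λ (S : CellSet n m) → Contaminating S × ∣ S ∣ ≡ γ) ×
  (∀ (S : CellSet n m) → Contaminating S → γ ≤ ∣ S ∣)

Optimal : CellSet n m → Set
Optimal {n} {m} S = Contaminating S × γc[ n , m ]≐ ∣ S ∣

Even Odd : ℕ → Set
Even x = 2 ∣ x
Odd  x = 2 ∤ x

SupportedOnOddColumns : CellSet n m → Set
SupportedOnOddColumns {n} {m} S = ∀ (u : Cell n m) → u ∈ S → Odd (col u)

{-# OPTIONS --safe #-}

-- Every rule contaminates a cell from columns i, i+1 only with the help of a cell already
-- in these columns.  Hence S meets the first column, the last column, and every pair of
-- consecutive columns.  With 2k+1 columns and k+1 cells this leaves no slack: the columns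
-- 3, …, 2k+1 need k cells by themselves, so that the first column takes one and the
-- second none, and one goes on by induction from the third column.
module Submission where

open import Defs
open import Data.Fin using (Fin)
open import Data.Nat using (ℕ; _+_; _*_; _≥_)
open import Data.Product using (_×_; _,_; ∃!)
open import Relation.Binary.PropositionalEquality using (_≡_)

open import Data.Fin using (zero; suc; toℕ; combine; _↑ˡ_; _↑ʳ_; _≟_)
open import Data.Fin.Properties using (toℕ<n; toℕ-injective)
open import Data.Fin.Subset as Sub using (Subset; Side; inside; outside)
open import Data.Fin.Subset.Properties using (nonempty?; Empty-unique; ∣⊥∣≡0; x∈p⇒∣p-x∣<∣p∣; x∈p∧x≢y⇒x∈p-y)
open import Data.Nat using (zero; suc; _≤_; _<_; z≤n; s≤s)
open import Data.Nat.Divisibility using (∣m+n∣m⇒∣n; ∣m∣n⇒∣m+n; ∣-refl; ∣1⇒≡1)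
open import Data.Nat.Properties as ℕₚ using (+-0-commutativeMonoid; ≤-trans; ≤-reflexive; ≤-antisym; <⇒≱; <-irrefl; suc-injective)
open import Data.Product using (∃; proj₁; proj₂)
open import Data.Sum using (_⊎_; inj₁; inj₂; [_,_]′)
open import Data.Vec using ([]; _∷_; lookup; tabulate)
open import Data.Vec.Properties using (lookup∘tabulate; lookup⇒[]=; []=⇒lookup)
open import Function using (_∘_)
open import Relation.Binary.PropositionalEquality using (refl; sym; trans; cong; subst)
open import Relation.Nullary using (yes; no; contradiction)
open import Algebra.Properties.CommutativeMonoid.Sum +-0-commutativeMonoid using (sum; sum-syntax; sum-cong-≗; ∑-comm)

open ℕₚ.≤-Reasoning

private
  variable
    n m : ℕ

x∈p⇒0<∣p∣ : ∀ {p : Subset n} {x} → x Sub.∈ p → 0 < Sub.∣ p ∣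
x∈p⇒0<∣p∣ x∈p = ℕₚ.≤-<-trans z≤n (x∈p⇒∣p-x∣<∣p∣ x∈p)

-- If `x` and `y` differed, `x` would survive the removal of `y`, so `p` would have at least two
-- elements.
∣p∣≤1⇒unique : ∀ {p : Subset n} {x y} → Sub.∣ p ∣ ≤ 1 → x Sub.∈ p → y Sub.∈ p → x ≡ y
∣p∣≤1⇒unique {x = x} {y} ∣p∣≤1 x∈p y∈p with x ≟ y
... | yes x≡y = x≡y
... | no x≢y = contradiction ∣p∣≤1 (<⇒≱ (ℕₚ.≤-<-trans
  (x∈p⇒0<∣p∣ (x∈p∧x≢y⇒x∈p-y x∈p x≢y)) (x∈p⇒∣p-x∣<∣p∣ y∈p)))

0<∣p∣⇒nonempty : ∀ {p : Subset n} → 0 < Sub.∣ p ∣ → Sub.Nonempty p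
0<∣p∣⇒nonempty {n} {p} 0<∣p∣ with nonempty? p
... | yes x∈p = x∈p
... | no empty = contradiction 0<∣p∣ (<-irrefl (sym (trans (cong Sub.∣_∣ (Empty-unique empty)) (∣⊥∣≡0 n))))

bit : Side → ℕ
bit inside  = 1
bit outside = 0

∣p∣≡∑bit : ∀ (p : Subset n) → Sub.∣ p ∣ ≡ sum (bit ∘ lookup p)
∣p∣≡∑bit []            = refl
∣p∣≡∑bit (inside  ∷ p) = cong suc (∣p∣≡∑bit p)
∣p∣≡∑bit (outside ∷ p) = ∣p∣≡∑bit p

sum-↑ : ∀ m (t : Fin (m + n) → ℕ) → sum t ≡ sum (t ∘ (_↑ˡ n)) + sum (t ∘ (m ↑ʳ_))
sum-↑ zero    t = refl
sum-↑ (suc m) t = trans (cong (t zero +_) (sum-↑ m (t ∘ suc))) (sym (ℕₚ.+-assoc (t zero) _ _))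

sum-combine : ∀ n (t : Fin (n * m) → ℕ) → sum t ≡ ∑[ i < n ] ∑[ j < m ] t (combine i j)
sum-combine         zero    t = refl
sum-combine {m = m} (suc n) t = trans (sum-↑ m t) (cong (∑[ j < m ] t (j ↑ˡ (n * m)) +_) (sum-combine n (t ∘ (m ↑ʳ_))))

column : CellSet n m → Fin m → Subset n
column S j = tabulate λ i → lookup (subset S) (combine i j)

∈⇒∈column : ∀ (S : CellSet n m) u → u ∈ S → proj₁ u Sub.∈ column S (proj₂ u)
∈⇒∈column S (i , j) u∈S = lookup⇒[]= i _ (trans (lookup∘tabulate _ i) ([]=⇒lookup u∈S))

∈column⇒∈ : ∀ (S : CellSet n m) {i j} → i Sub.∈ column S j → (i , j) ∈ S
∈column⇒∈ S {i} i∈ = lookup⇒[]= _ (subset S) (trans (sym (lookup∘tabulate _ i)) ([]=⇒lookup i∈))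

-- Double counting: `combine` enumerates the cells row by row, so the sum over all cells splits by
-- rows, and exchanging the two sums gives columns.
∑∣column∣≡∣S∣ : ∀ (S : CellSet n m) → ∑[ j < m ] Sub.∣ column S j ∣ ≡ ∣ S ∣
∑∣column∣≡∣S∣ {n} {m} S = let s = λ i j → bit (lookup (subset S) (combine i j)) in begin-equality
  ∑[ j < m ] Sub.∣ column S j ∣  ≡⟨ sum-cong-≗ (λ j → trans (∣p∣≡∑bit (column S j))
                                      (sum-cong-≗ {n} (λ i → cong bit (lookup∘tabulate _ i)))) ⟩
  ∑[ j < m ] ∑[ i < n ] s i j    ≡⟨ ∑-comm {n} {m} s ⟨
  ∑[ i < n ] ∑[ j < m ] s i j    ≡⟨ sum-combine n (bit ∘ lookup (subset S)) ⟨
  sum (bit ∘ lookup (subset S))  ≡⟨ ∣p∣≡∑bit (subset S) ⟨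
  ∣ S ∣                          ∎

-- x ranges over all naturals: there are no columns 0 and m + 1, so x = 0 and x = m
-- give the first and the last column.
InPair : ℕ → Cell n m → Set
InPair x u = col u ≡ x ⊎ col u ≡ suc x

-- In (a), (b) and (d), `v` and `w` lie in the two columns adjacent to that of `u`, and one of these
-- is the other column of the pair. In each remaining rule, `v` or `w` shares the column of `u`.
pair-rule : ∀ {x} {u v w : Cell n m} → Rule u v w → InPair x u → InPair x v ⊎ InPair x w
pair-rule (a _ p _ q) (inj₁ r) = inj₂ (inj₂ (trans q (cong suc r)))
pair-rule (a _ p _ q) (inj₂ r) = inj₁ (inj₁ (suc-injective (trans p r)))
pair-rule (b _ p _ q) (inj₁ r) = inj₂ (inj₂ (trans q (cong suc r)))
pair-rule (b _ p _ q) (inj₂ r) = inj₁ (inj₁ (suc-injective (trans p r)))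
pair-rule (c _ p _ _) (inj₁ r) = inj₁ (inj₁ (trans p r))
pair-rule (c _ p _ _) (inj₂ r) = inj₁ (inj₂ (trans p r))
pair-rule (d _ p _ q) (inj₁ r) = inj₂ (inj₂ (trans q (cong suc r)))
pair-rule (d _ p _ q) (inj₂ r) = inj₁ (inj₁ (suc-injective (trans p r)))
pair-rule (e _ _ _ q) (inj₁ r) = inj₂ (inj₁ (trans q r))
pair-rule (e _ _ _ q) (inj₂ r) = inj₂ (inj₂ (trans q r))
pair-rule (f _ _ _ q) (inj₁ r) = inj₂ (inj₁ (trans q r))
pair-rule (f _ _ _ q) (inj₂ r) = inj₂ (inj₂ (trans q r))
pair-rule (g _ p _ _) (inj₁ r) = inj₁ (inj₁ (trans p r))
pair-rule (g _ p _ _) (inj₂ r) = inj₁ (inj₂ (trans p r))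
pair-rule (h _ p _ _) (inj₁ r) = inj₁ (inj₁ (trans p r))
pair-rule (h _ p _ _) (inj₂ r) = inj₁ (inj₂ (trans p r))

-- Following `pair-rule` backwards through the derivation never leaves the pair of columns and ends
-- at an initial cell.
pair-meets : ∀ {S : CellSet n m} x {u} → C S u → InPair x u → ∃ λ v → v ∈ S × InPair x v
pair-meets x (initial u∈S)  q = _ , u∈S , q
pair-meets x (spread r v w) q = [ pair-meets x v , pair-meets x w ]′ (pair-rule r q)

NoGap : (Fin n → ℕ) → Set
NoGap t = ∀ i j → toℕ j ≡ suc (toℕ i) → 1 ≤ t i + t j

EndsPositive : (Fin n → ℕ) → Set
EndsPositive {n} t = ∀ j → suc (toℕ j) ≡ n → 1 ≤ t j

drop₂ : (Fin (suc (suc n)) → ℕ) → Fin n → ℕ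
drop₂ t j = t (suc (suc j))

noGap-drop₂ : ∀ (t : Fin (suc (suc n)) → ℕ) → NoGap t → NoGap (drop₂ t)
noGap-drop₂ t gap i j eq = gap (suc (suc i)) (suc (suc j)) (cong (2 +_) eq)

endsPositive-drop₂ : ∀ (t : Fin (suc (suc n)) → ℕ) → EndsPositive t → EndsPositive (drop₂ t)
endsPositive-drop₂ t end j eq = end (suc (suc j)) (cong (2 +_) eq)

-- The first `k * 2` entries form `k` disjoint consecutive pairs, each contributing at least 1, and
-- the last entry adds one more. The length is written `suc (k * 2)` so that a successor step on `k`
-- exposes the next pair.
k<∑ : ∀ k (t : Fin (suc (k * 2)) → ℕ) → NoGap t → EndsPositive t → k < sum t
k<∑ zero    t gap end = ≤-trans (end zero refl) (ℕₚ.m≤m+n _ 0)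
k<∑ (suc k) t gap end = begin
  1 + suc k                                  ≤⟨ ℕₚ.+-mono-≤ (gap zero (suc zero) refl)
                                                  (k<∑ k (drop₂ t) (noGap-drop₂ t gap) (endsPositive-drop₂ t end)) ⟩
  (t zero + t (suc zero)) + sum (drop₂ t)    ≡⟨ ℕₚ.+-assoc (t zero) _ _ ⟩
  sum t                                      ∎

even-2+⇒even : ∀ x → Even (2 + x) → Even x
even-2+⇒even x p = ∣m+n∣m⇒∣n p ∣-refl

odd-2+⇒odd : ∀ x → Odd (2 + x) → Odd x
odd-2+⇒odd x p q = p (∣m∣n⇒∣m+n ∣-refl q)

-- Here `x`, `y` and `r` stand for the first entry, the second entry and the sum of all later ones.
module _ {k} x y r (total : x + (y + r) ≤ suc k) (0<x : 0 < x) (k≤r : k ≤ r) where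

  private
    x+y≤1 : x + y ≤ 1
    x+y≤1 = ℕₚ.+-cancelʳ-≤ r _ _ (begin
      x + y + r    ≡⟨ ℕₚ.+-assoc x y r ⟩
      x + (y + r)  ≤⟨ total ⟩
      suc k        ≤⟨ s≤s k≤r ⟩
      1 + r        ∎)

  first-tight : x ≡ 1
  first-tight = ≤-antisym (ℕₚ.m+n≤o⇒m≤o x x+y≤1) 0<x

  second-tight : y ≡ 0
  second-tight = ℕₚ.n≤0⇒n≡0 (ℕₚ.+-cancelˡ-≤ 1 _ _ (≤-trans (ℕₚ.+-monoˡ-≤ y 0<x) x+y≤1))

  rest-tight : r ≤ k
  rest-tight = ℕₚ.+-cancelˡ-≤ 1 _ _ (≤-trans (ℕₚ.+-mono-≤ 0<x (ℕₚ.m≤n+m r y)) total)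

-- Induction two entries at a time; positivity of the leading entry has to be re-established at the
-- third entry.
forced : ∀ k (t : Fin (suc (k * 2)) → ℕ) → 0 < t zero → NoGap t → EndsPositive t → sum t ≤ suc k →
         ∀ j → (Odd (index j) → t j ≡ 1) × (Even (index j) → t j ≡ 0)
forced zero    t 0<t₀ gap end total zero =
  -- A single column: the second entry and the rest are both taken to be 0.
  (λ _ → first-tight (t zero) 0 0 total 0<t₀ z≤n) ,
  λ even → contradiction (∣1⇒≡1 even) λ()
forced (suc k) t 0<t₀ gap end total j = go j
  where
  gap₂ : NoGap (drop₂ t)
  gap₂ = noGap-drop₂ t gap

  end₂ : EndsPositive (drop₂ t)
  end₂ = endsPositive-drop₂ t end

  -- Unfolded, this is `suc k ≤ sum (drop₂ t)`, the lower bound on the rest that the tightness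
  -- lemmas require at `suc k`.
  k<∑₂ : k < sum (drop₂ t)
  k<∑₂ = k<∑ k (drop₂ t) gap₂ end₂

  t₁≡0 : t (suc zero) ≡ 0
  t₁≡0 = second-tight (t zero) (t (suc zero)) (sum (drop₂ t)) total 0<t₀ k<∑₂

  -- Since the second entry vanishes, the pair of second and third entries must get its 1 from the
  -- third.
  0<t₂ : 0 < t (suc (suc zero))
  0<t₂ = subst (λ y → 1 ≤ y + t (suc (suc zero))) t₁≡0 (gap (suc zero) (suc (suc zero)) refl)

  go : ∀ j → (Odd (index j) → t j ≡ 1) × (Even (index j) → t j ≡ 0)
  go zero = (λ _ → first-tight (t zero) (t (suc zero)) (sum (drop₂ t)) total 0<t₀ k<∑₂) , λ even → contradiction (∣1⇒≡1 even) λ()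
  go (suc zero) = (λ odd → contradiction ∣-refl odd) , λ _ → t₁≡0
  go (suc (suc j)) =
    let odd⇒1 , even⇒0 = forced k (drop₂ t) 0<t₂ gap₂ end₂ (rest-tight (t zero) (t (suc zero)) (sum (drop₂ t)) total 0<t₀ k<∑₂) j
    in odd⇒1 ∘ odd-2+⇒odd (index j) , even⇒0 ∘ even-2+⇒even (index j)

-- With `suc n` rows every column contains the cell `(zero , j)`, whose contamination is traced back
-- to `S`.
module _ {n m} {S : CellSet (suc n) m} (full : Contaminating S) where

  private
    size : Fin m → ℕ
    size j = Sub.∣ column S j ∣

    index-injective : ∀ {i j : Fin m} → index i ≡ index j → i ≡ j
    index-injective = toℕ-injective ∘ suc-injective

    0<size : ∀ {j} u → u ∈ S → col u ≡ index j → 0 < size j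
    0<size u u∈S eq = subst (λ j → 0 < size j) (index-injective eq) (x∈p⇒0<∣p∣ (∈⇒∈column S u u∈S))

  first-column : ∀ j → toℕ j ≡ 0 → 0 < size j
  first-column j eq with pair-meets 0 (full (zero , j)) (inj₂ (cong suc eq))
  ... | u , u∈S , inj₂ q = 0<size u u∈S (trans q (cong suc (sym eq)))

  column-noGap : NoGap size
  column-noGap i j eq with pair-meets (index i) (full (zero , i)) (inj₁ refl)
  ... | u , u∈S , inj₁ q = ≤-trans (0<size u u∈S q) (ℕₚ.m≤m+n _ _)
  ... | u , u∈S , inj₂ q = ≤-trans (0<size u u∈S (trans q (cong suc (sym eq)))) (ℕₚ.m≤n+m _ _)

  column-endsPositive : EndsPositive size
  column-endsPositive j eq with pair-meets m (full (zero , j)) (inj₁ eq)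
  ... | u , u∈S , inj₁ q = 0<size u u∈S (trans q (sym eq))
  ... | u , u∈S , inj₂ q = contradiction (toℕ<n (proj₂ u)) (<-irrefl (suc-injective q))

column-size : ∀ k {S : CellSet (suc n) (suc (k * 2))} → Contaminating S → ∣ S ∣ ≡ suc k → ∀ j →
              (Odd (index j) → Sub.∣ column S j ∣ ≡ 1) × (Even (index j) → Sub.∣ column S j ∣ ≡ 0)
column-size k {S} full ∣S∣≡ = forced k _ (first-column full zero refl) (column-noGap full)
  (column-endsPositive full) (≤-reflexive (trans (∑∣column∣≡∣S∣ S) ∣S∣≡))

odd-column : ∀ {S : CellSet n m} j → Sub.∣ column S j ∣ ≡ 1 → ∃! _≡_ (λ i → (i , j) ∈ S)
odd-column {S = S} j eq with 0<∣p∣⇒nonempty (≤-reflexive (sym eq))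
... | i , i∈ = i , ∈column⇒∈ S i∈ , λ {i′} u∈S → ∣p∣≤1⇒unique (≤-reflexive eq) i∈ (∈⇒∈column S (i′ , j) u∈S)

even-column : ∀ {S : CellSet n m} u → Sub.∣ column S (proj₂ u) ∣ ≡ 0 → u ∉ S
even-column {S = S} u eq u∈S = <-irrefl (sym eq) (x∈p⇒0<∣p∣ (∈⇒∈column S u u∈S))

-- This carries the size `k + 1` from the given `S` to every other optimal set, as the last claim of
-- `lemma5` requires.
optimal-size-unique : ∀ {S T : CellSet n m} → Optimal S → Optimal T → ∣ S ∣ ≡ ∣ T ∣
optimal-size-unique (fullS , _ , minS) (fullT , _ , minT) = ≤-antisym (minS _ fullT) (minT _ fullS)

lemma5 : ∀ (n m k : ℕ) → m ≡ 2 * k + 1 → m ≥ n → n ≥ 3 →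
    ∀ (S : CellSet n m) → Optimal S → ∣ S ∣ ≡ k + 1 →
    (∀ (j : Fin m) → Odd (index j) → ∃! _≡_ (λ (i : Fin n) → (i , j) ∈ S))
    × (∀ (j : Fin m) → Even (index j) → ∀ (i : Fin n) → (i , j) ∉ S)
    × (∀ (T : CellSet n m) → Optimal T → SupportedOnOddColumns T)
lemma5 (suc n) m k m≡2k+1 m≥n n≥3 S opt ∣S∣≡k+1
  -- The number of columns is brought into the form `suc (k * 2)` on which `forced` recurses.
  with refl ← trans m≡2k+1 (trans (ℕₚ.+-comm (2 * k) 1) (cong suc (ℕₚ.*-comm 2 k))) =
  (λ j odd → odd-column {S = S} j (proj₁ (sizes S opt j) odd)) ,
  (λ j even i → even-column {S = S} (i , j) (proj₂ (sizes S opt j) even)) ,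
  (λ T optT (i , j) u∈T even → even-column {S = T} (i , j) (proj₂ (sizes T optT j) even) u∈T)
  where
  sizes : ∀ (T : CellSet (suc n) (suc (k * 2))) → Optimal T → ∀ j →
          (Odd (index j) → Sub.∣ column T j ∣ ≡ 1) × (Even (index j) → Sub.∣ column T j ∣ ≡ 0)
  sizes T optT = column-size k (proj₁ optT)
    (trans (optimal-size-unique optT opt) (trans ∣S∣≡k+1 (ℕₚ.+-comm k 1)))
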